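{- Let $n\ge 1$ and $k$ be integers with $\lfloor n/2\rfloor \le k\le \lfloor (2n-2)/3\rfloor$. Then the graphs $\Phi^n_k$, $A_{2n-3k-2,\,2k-n+1}$ and $\Pi_{2n-3k-2,\,2k-n+1}$ are pairwise isomorphic: $$\Phi^n_k\cong A_{2n-3k-2,\,2k-n+1}\cong \Pi_{2n-3k-2,\,2k-n+1}.$$
   Context: A subword of a word is a block of consecutive letters. A binary word (over $\{0,1\}$) of length $n\ge 1$ is Padovan if it starts and ends with $0$, contains no subword $00$, and contains no subword $111$. For $n\ge1$ and $\lfloor n/2\rfloor\le k\le\lfloor(2n-2)/3\rfloor$, the weighted Padovan graph $\Phi^n_k$ is the simple graph whose vertices are all Padovan words of length $n$ with exactly $k$ letters $1$; two vertices are adjacent if one can be obtained from the other by replacing exactly one subword $01$ with $10$. For nonnegative integers $p,q$, the graph $A_{p,q}$ has as vertices all words of length $p+q$ over $\{a,b\}$ with exactly $p$ letters $a$ and $q$ letters $b$; two words are adjacent if one can be obtained from the other by changing one subword $ab$ to $ba$. For nonnegative integers $p,q$, the graph $\Pi_{p,q}$ has as vertices all integer sequences $(\lambda_1,\dots,\lambda_q)$ with $p\ge\lambda_1\ge\cdots\ge\lambda_q\ge 0$ (weak partitions into $q$ parts, parts $0$ allowed, with largest part at most $p$); two vertices are adjacent if one can be obtained from the other by adding $1$ to one of the parts. -}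

module Defs where

open import Data.Fin.Base using (Fin)
open import Data.Fin.Patterns using (0F; 1F)
import Data.Fin.Properties as Fin
open import Data.List.Base
  using (List; []; _∷_; _++_; length; filter; head; last)
open import Data.List.Properties using (++-cancelˡ; ∷-injectiveˡ)
open import Data.List.Relation.Binary.Infix.Heterogeneous using (Infix)
open import Data.Maybe.Base using (just)
open import Data.Nat.Base using (ℕ; suc; _+_; _≥_)
open import Data.Nat.Properties using (1+n≢n)
open import Data.Product.Base using (_×_; _,_; ∃-syntax)
open import Data.Refinement using (Refinement-syntax; value)
open import Data.Vec.Base using (Vec; _∷_; updateAt; lookup)
open import Data.Vec.Properties using (lookup∘updateAt)
open import Data.Vec.Relation.Unary.Linked using (Linked)
open import Function.Base using (_on_)
open import Function.Bundles using (_↔_; _⇔_; Inverse)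
open import Relation.Binary.Construct.Closure.Symmetric
  using (SymClosure; fwd; bwd; symmetric)
open import Relation.Binary.Definitions
  using (Symmetric; DecidableEquality)
open import Relation.Binary.PropositionalEquality
  using (_≡_; _≢_; refl; sym; trans; cong)
open import Relation.Nullary using (¬_; yes; no)

record SimpleGraph : Set₁ where
  infix 4 _~_
  field
    Vertex : Set
    _~_    : Vertex → Vertex → Set
    ~-sym  : Symmetric _~_
    ~-irr  : ∀ {v} → ¬ (v ~ v)

infix 4 _≅_

record _≅_ (G H : SimpleGraph) : Set where
  private
    module G = SimpleGraph G
    module H = SimpleGraph H
  field
    bijection : G.Vertex ↔ H.Vertex
    adjacency : ∀ u v →
      u G.~ v ⇔ Inverse.to bijection u H.~ Inverse.to bijection v

module _ {A : Set} where

  infix 4 _Subword_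

  _Subword_ : List A → List A → Set
  _Subword_ = Infix _≡_

  Replace : A → A → List A → List A → Set
  Replace x y u v =
    ∃[ l ] ∃[ r ] (u ≡ l ++ x ∷ y ∷ r) × (v ≡ l ++ y ∷ x ∷ r)

  Exchange : A → A → List A → List A → Set
  Exchange x y = SymClosure (Replace x y)

  Replace-irr : ∀ {x y} → x ≢ y → ∀ {w} → ¬ Replace x y w w
  Replace-irr x≢y (l , r , p , q) =
    x≢y (∷-injectiveˡ (++-cancelˡ l _ _ (trans (sym p) q)))

  Exchange-irr : ∀ {x y} → x ≢ y → ∀ {w} → ¬ Exchange x y w w
  Exchange-irr x≢y (fwd s) = Replace-irr x≢y s
  Exchange-irr x≢y (bwd s) = Replace-irr x≢y s

  occurrences : DecidableEquality A → A → List A → ℕ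
  occurrences _≟_ x w = length (filter (x ≟_) w)

-- The defining property of a vertex is stored irrelevantly (`Refinement`), so
-- that two vertices are equal as soon as the underlying words are.
wordGraph : {A : Set} (P : List A → Set) (x y : A) → x ≢ y → SimpleGraph
wordGraph {A} P x y x≢y = record
  { Vertex = [ w ∈ List A ∣ P w ]
  ; _~_    = Exchange x y on value
  ; ~-sym  = symmetric (Replace x y)
  ; ~-irr  = Exchange-irr x≢y
  }

record Padovan (w : List (Fin 2)) : Set where
  field
    starts-0 : head w ≡ just 0F
    ends-0   : last w ≡ just 0F
    no-00    : ¬ ((0F ∷ 0F ∷ []) Subword w)
    no-111   : ¬ ((1F ∷ 1F ∷ 1F ∷ []) Subword w)

Φ : (n k : ℕ) → SimpleGraph
Φ n k = wordGraph
  (λ w → Padovan w × length w ≡ n × occurrences Fin._≟_ 1F w ≡ k)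
  0F 1F (λ ())

data Letter : Set where
  a b : Letter

_≟ᴸ_ : DecidableEquality Letter
a ≟ᴸ a = yes refl
a ≟ᴸ b = no λ ()
b ≟ᴸ a = no λ ()
b ≟ᴸ b = yes refl

A⟨_,_⟩ : (p q : ℕ) → SimpleGraph
A⟨ p , q ⟩ = wordGraph
  (λ w → length w ≡ p + q
       × occurrences _≟ᴸ_ a w ≡ p
       × occurrences _≟ᴸ_ b w ≡ q)
  a b (λ ())

AddOne : ∀ {q} → Vec ℕ q → Vec ℕ q → Set
AddOne μ ν = ∃[ i ] ν ≡ updateAt μ i suc

AddOne-irr : ∀ {q} {μ : Vec ℕ q} → ¬ AddOne μ μ
AddOne-irr {μ = μ} (i , p) =
  1+n≢n (sym (trans (cong (λ ν → lookup ν i) p) (lookup∘updateAt i μ)))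

-- `Linked _≥_ (p ∷ μ)` is the chain p ≥ μ₁ ≥ ⋯ ≥ μ_q; for q = 0 it holds
-- trivially, so that Π⟨ p , 0 ⟩ has the empty sequence as its only vertex.
Π⟨_,_⟩ : (p q : ℕ) → SimpleGraph
Π⟨ p , q ⟩ = record
  { Vertex = [ μ ∈ Vec ℕ q ∣ Linked _≥_ (p ∷ μ) ]
  ; _~_    = SymClosure AddOne on value
  ; ~-sym  = symmetric AddOne
  ; ~-irr  = λ { (fwd s) → AddOne-irr s ; (bwd s) → AddOne-irr s }
  }

-- A Padovan word factors uniquely as a product of blocks 01 and 011 followed by
-- a final 0.  Reading 01 as a and 011 as b, the exchange ab → ba turns 01·011
-- into 011·01, which replaces the 01 that begins the second block by 10.  No
-- other exchange 01 → 10 keeps the word Padovan: at the first block it produces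
-- an initial 1, after a block 011 a subword 111, and at a block 01 preceded by
-- a block 01 a subword 00.  A word in a and b corresponds to the sequence that
-- counts, for each b, the letters a to its right; ab → ba adds 1 to one part.
module Submission where

open import Defs
open import Data.Nat using (ℕ; _+_; _*_; _∸_; _/_; _≤_)
open import Data.Product using (_×_)

open import Data.Fin.Base using (Fin; zero; suc)
open import Data.Fin.Patterns using (0F; 1F)
import Data.Fin.Properties as Fin
open import Data.Irrelevant using ([_])
open import Data.List.Base using (List; []; _∷_; _++_; length; replicate; head; last)
open import Data.List.Properties using (∷-injectiveʳ)
import Data.List.Properties as List
open import Data.List.Relation.Binary.Infix.Heterogeneous using (here; there)
open import Data.List.Relation.Binary.Prefix.Heterogeneous using ([]; _∷_)
open import Data.Maybe.Base using (just)
open import Data.Nat.Base using (zero; suc; _≥_; _%_; s≤s)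
open import Data.Nat.DivMod using (m≡m%n+[m/n]*n; m/n*n≤m; m%n<n)
open import Data.Nat.Properties
open import Data.Nat.Tactic.RingSolver using (solve-∀)
open import Data.Product.Base using (_,_; proj₁; proj₂)
open import Data.Refinement using (Refinement; _,_; value; value-injective)
import Data.Refinement as Refinement
open import Data.Vec.Base using (Vec; []; _∷_)
import Data.Vec.Base as Vec
import Data.Vec.Properties as Vec
open import Data.Vec.Relation.Unary.Linked using (Linked; [-]; _∷_; linked?)
open import Function.Base using (_on_)
open import Function.Bundles using (mk⇔; mk↔ₛ′)
open import Function.Construct.Composition using (_⇔-∘_; _↔-∘_)
open import Relation.Binary.Construct.Closure.Symmetric
  using (SymClosure; fwd; bwd; symmetric)
open import Relation.Binary.Definitions using (DecidableEquality)
open import Relation.Binary.PropositionalEquality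
open import Relation.Nullary using (¬_; contradiction)
open import Relation.Nullary.Decidable using (recompute)

-- Isomorphisms between graphs on refined vertex sets.

≅-trans : ∀ {G H K} → G ≅ H → H ≅ K → G ≅ K
≅-trans G≅H H≅K = record
  { bijection = H≅K.bijection ↔-∘ G≅H.bijection
  ; adjacency = λ u v → H≅K.adjacency _ _ ⇔-∘ G≅H.adjacency u v
  }
  where
  module G≅H = _≅_ G≅H
  module H≅K = _≅_ H≅K

module _ {V : Set} (P : V → Set) (R : V → V → Set) where

  -- A common shape for the three families: `Φ`, `A⟨_,_⟩` and `Π⟨_,_⟩` unfold to instances of it.
  symmetricGraph : (∀ {v : Refinement V P} → ¬ SymClosure R (value v) (value v)) →
                   SimpleGraph
  symmetricGraph irr = record
    { Vertex = Refinement V P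
    ; _~_    = SymClosure R on value
    ; ~-sym  = symmetric R
    ; ~-irr  = λ {v} → irr {v}
    }

module _
  {V W : Set} {P : V → Set} {Q : W → Set} {R : V → V → Set} {S : W → W → Set}
  (_≟ⱽ_ : DecidableEquality V) (_≟ᵂ_ : DecidableEquality W)
  (f : V → W) (g : W → V)
  (f-pres : ∀ {v} → P v → Q (f v)) (g-pres : ∀ {w} → Q w → P (g w))
  (f∘g : ∀ {w} → Q w → f (g w) ≡ w) (g∘f : ∀ {v} → P v → g (f v) ≡ v)
  (f-step : ∀ {u v} → .(P u) → .(P v) → R u v → S (f u) (f v))
  (g-step : ∀ {u v} → .(Q u) → .(Q v) → S u v → R (g u) (g v))
  where

  -- Preserving directed steps both ways is enough: an adjacency between images is carried back by
  -- `g` and then transported along `g (f v) ≡ v`. The step hypotheses take the vertex conditions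
  -- irrelevantly because a vertex offers them only in that form.
  symmetricGraph-≅ :
    (irr  : ∀ {v : Refinement V P} → ¬ SymClosure R (value v) (value v)) →
    (irr′ : ∀ {w : Refinement W Q} → ¬ SymClosure S (value w) (value w)) →
    symmetricGraph P R (λ {v} → irr {v}) ≅ symmetricGraph Q S (λ {w} → irr′ {w})
  symmetricGraph-≅ irr irr′ = record
    { bijection = mk↔ₛ′ (Refinement.map f f-pres) (Refinement.map g g-pres)
        -- The condition `q` is irrelevant, so the equation it implies is recovered from decidable
        -- equality.
        (λ { (w , [ q ]) → value-injective (recompute (f (g w) ≟ᵂ w) (f∘g q)) })
        (λ { (v , [ p ]) → value-injective (recompute (g (f v) ≟ⱽ v) (g∘f p)) })
    ; adjacency = λ u v → mk⇔ (to u v) (from u v)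
    }
    where
    to : (u v : Refinement V P) →
         SymClosure R (value u) (value v) → SymClosure S (f (value u)) (f (value v))
    to (u , [ p ]) (v , [ p′ ]) (fwd s) = fwd (f-step p p′ s)
    to (u , [ p ]) (v , [ p′ ]) (bwd s) = bwd (f-step p′ p s)

    from : (u v : Refinement V P) →
           SymClosure S (f (value u)) (f (value v)) → SymClosure R (value u) (value v)
    from (u , [ p ]) (v , [ p′ ]) s = subst₂ (SymClosure R)
      (recompute (g (f u) ≟ⱽ u) (g∘f p)) (recompute (g (f v) ≟ⱽ v) (g∘f p′)) (back s)
      where
      back : SymClosure S (f u) (f v) → SymClosure R (g (f u)) (g (f v))
      back (fwd s) = fwd (g-step (f-pres p) (f-pres p′) s)
      back (bwd s) = bwd (g-step (f-pres p′) (f-pres p) s)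

-- Exchanges under a prefix and letter counts.

module _ {A : Set} {x y : A} where

  Replace-∷ : ∀ z {u v} → Replace x y u v → Replace x y (z ∷ u) (z ∷ v)
  Replace-∷ z (l , r , p , q) = z ∷ l , r , cong (z ∷_) p , cong (z ∷_) q

  Replace-++ : ∀ l {u v} → Replace x y u v → Replace x y (l ++ u) (l ++ v)
  Replace-++ []      s = s
  Replace-++ (z ∷ l) s = Replace-∷ z (Replace-++ l s)

#a #b : List Letter → ℕ
#a = occurrences _≟ᴸ_ a
#b = occurrences _≟ᴸ_ b

#1 : List (Fin 2) → ℕ
#1 = occurrences Fin._≟_ 1F

length≡#a+#b : ∀ w → length w ≡ #a w + #b w
length≡#a+#b []      = refl
length≡#a+#b (a ∷ w) = cong suc (length≡#a+#b w)
length≡#a+#b (b ∷ w) = trans (cong suc (length≡#a+#b w)) (sym (+-suc (#a w) (#b w)))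

-- Padovan words as words in blocks.

-- Bracketing the product as `0` followed by blocks `10` and `110` makes every code visibly start
-- with `0`, while `encode (a ∷ w)` still unfolds to `01` followed by `encode w`.
encode : List Letter → List (Fin 2)
encode w = 0F ∷ blocks w
  where
  blocks : List Letter → List (Fin 2)
  blocks []      = []
  blocks (a ∷ w) = 1F ∷ 0F ∷ blocks w
  blocks (b ∷ w) = 1F ∷ 1F ∷ 0F ∷ blocks w

-- A block is read only if a `0` follows; that `0` stays in the remainder, where it opens the next
-- block or is the final letter. The last clause serves the final `0` and is a default for words
-- that do not factor.
decode : List (Fin 2) → List Letter
decode (0F ∷ 1F ∷ w@(0F ∷ _))      = a ∷ decode w
decode (0F ∷ 1F ∷ 1F ∷ w@(0F ∷ _)) = b ∷ decode w
decode _                           = []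

decode∘encode : ∀ w → decode (encode w) ≡ w
decode∘encode []      = refl
decode∘encode (a ∷ w) = cong (a ∷_) (decode∘encode w)
decode∘encode (b ∷ w) = cong (b ∷_) (decode∘encode w)

encode-injective : ∀ {u v} → encode u ≡ encode v → u ≡ v
encode-injective {u} {v} eq =
  trans (sym (decode∘encode u)) (trans (cong decode eq) (decode∘encode v))

encode-padovan : ∀ w → Padovan (encode w)
encode-padovan w = record
  { starts-0 = refl ; ends-0 = ends w ; no-00 = no00 w ; no-111 = no111 w }
  where
  ends : ∀ w → last (encode w) ≡ just 0F
  ends []      = refl
  ends (a ∷ w) = ends w
  ends (b ∷ w) = ends w

  no00 : ∀ w → ¬ ((0F ∷ 0F ∷ []) Subword encode w)
  no00 []      (here (_ ∷ ()))
  no00 []      (there (here ()))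
  no00 (a ∷ w) (here (_ ∷ () ∷ _))
  no00 (a ∷ w) (there (here (() ∷ _)))
  no00 (a ∷ w) (there (there s))              = no00 w s
  no00 (b ∷ w) (here (_ ∷ () ∷ _))
  no00 (b ∷ w) (there (here (() ∷ _)))
  no00 (b ∷ w) (there (there (here (() ∷ _))))
  no00 (b ∷ w) (there (there (there s)))      = no00 w s

  no111 : ∀ w → ¬ ((1F ∷ 1F ∷ 1F ∷ []) Subword encode w)
  no111 []      (here (() ∷ _))
  no111 []      (there (here ()))
  no111 (a ∷ w) (here (() ∷ _))
  no111 (a ∷ w) (there (here (_ ∷ () ∷ _)))
  no111 (a ∷ w) (there (there s))             = no111 w s
  no111 (b ∷ w) (here (() ∷ _))
  no111 (b ∷ w) (there (here (_ ∷ _ ∷ () ∷ _)))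
  no111 (b ∷ w) (there (there (here (_ ∷ () ∷ _))))
  no111 (b ∷ w) (there (there (there s)))     = no111 w s

-- Every prefix that `decode` does not read as a block contradicts one of the four conditions,
-- except the final `0`. The remainder after a block starts with `0` and inherits the other
-- conditions.
encode∘decode : ∀ {w} → Padovan w → encode (decode w) ≡ w
encode∘decode {w} P = go w starts-0 ends-0 no-00 no-111
  where
  open Padovan P
  go : ∀ w → head w ≡ just 0F → last w ≡ just 0F →
       ¬ ((0F ∷ 0F ∷ []) Subword w) → ¬ ((1F ∷ 1F ∷ 1F ∷ []) Subword w) →
       encode (decode w) ≡ w
  go []                              ()
  go (1F ∷ _)                        ()
  go (0F ∷ [])                       _ _ _ _ = refl
  go (0F ∷ 0F ∷ w)                   _ _ no00 _ =
    contradiction (here (refl ∷ refl ∷ [])) no00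
  go (0F ∷ 1F ∷ [])                  _ ()
  go (0F ∷ 1F ∷ w@(0F ∷ _))          _ e no00 no111 = cong (λ w → 0F ∷ 1F ∷ w)
    (go w refl e (λ s → no00 (there (there s))) (λ s → no111 (there (there s))))
  go (0F ∷ 1F ∷ 1F ∷ [])             _ ()
  go (0F ∷ 1F ∷ 1F ∷ w@(0F ∷ _))     _ e no00 no111 = cong (λ w → 0F ∷ 1F ∷ 1F ∷ w)
    (go w refl e (λ s → no00 (there (there (there s))))
                 (λ s → no111 (there (there (there s)))))
  go (0F ∷ 1F ∷ 1F ∷ 1F ∷ w)         _ _ _ no111 =
    contradiction (there (here (refl ∷ refl ∷ refl ∷ []))) no111

encode-step : ∀ {u v} → Replace a b u v → Replace 0F 1F (encode u) (encode v)
encode-step ([] , r , refl , refl) = 0F ∷ 1F ∷ [] , _ , refl , refl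
encode-step (a ∷ l , r , refl , refl) =
  Replace-++ (0F ∷ 1F ∷ []) (encode-step (l , r , refl , refl))
encode-step (b ∷ l , r , refl , refl) =
  Replace-++ (0F ∷ 1F ∷ 1F ∷ []) (encode-step (l , r , refl , refl))

-- Common first blocks are stripped. An exchange at the very start, or directly after a stripped
-- block, would make the remaining code of `v` start with `1`. If the first blocks differ, comparing
-- letters forces `a` in `u`, `b` in `v` and the exchange right after the first `01`.
encode-step⁻¹ : ∀ u v → Replace 0F 1F (encode u) (encode v) → Replace a b u v
encode-step⁻¹ u       v       ([] , r , p , ())
encode-step⁻¹ []      v       (_ ∷ [] , r , () , q)
encode-step⁻¹ []      v       (_ ∷ _ ∷ l , r , () , q)
encode-step⁻¹ (a ∷ u) v       (_ ∷ [] , r , () , q)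
encode-step⁻¹ (b ∷ u) v       (_ ∷ [] , r , () , q)
encode-step⁻¹ (a ∷ u) []      (_ ∷ _ ∷ l , r , p , ())
encode-step⁻¹ (a ∷ u) (a ∷ v) (_ ∷ _ ∷ l , r , p , q) = Replace-∷ a (encode-step⁻¹ u v
  (l , r , ∷-injectiveʳ (∷-injectiveʳ p) , ∷-injectiveʳ (∷-injectiveʳ q)))
encode-step⁻¹ (a ∷ [])    (b ∷ v)     (_ ∷ _ ∷ [] , r , () , q)
-- With a second block `01` in `u` the result would begin with `01100`, but after `0110` a code ends
-- or continues with `1`.
encode-step⁻¹ (a ∷ a ∷ u) (b ∷ [])    (_ ∷ _ ∷ [] , r , refl , ())
encode-step⁻¹ (a ∷ a ∷ u) (b ∷ a ∷ v) (_ ∷ _ ∷ [] , r , refl , ())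
encode-step⁻¹ (a ∷ a ∷ u) (b ∷ b ∷ v) (_ ∷ _ ∷ [] , r , refl , ())
encode-step⁻¹ (a ∷ b ∷ u) (b ∷ v)     (_ ∷ _ ∷ [] , r , refl , q) =
  [] , u , refl ,
  cong (b ∷_) (encode-injective (∷-injectiveʳ (∷-injectiveʳ (∷-injectiveʳ q))))
encode-step⁻¹ (a ∷ u) (b ∷ v) (_ ∷ _ ∷ 0F ∷ l , r , p , ())
encode-step⁻¹ (a ∷ u) (b ∷ v) (_ ∷ _ ∷ 1F ∷ l , r , () , q)
encode-step⁻¹ (b ∷ u) []      (_ ∷ _ ∷ l , r , p , ())
encode-step⁻¹ (b ∷ u) v       (_ ∷ _ ∷ [] , r , () , q)
encode-step⁻¹ (b ∷ u) (a ∷ v) (_ ∷ _ ∷ 0F ∷ l , r , () , q)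
encode-step⁻¹ (b ∷ u) (a ∷ v) (_ ∷ _ ∷ 1F ∷ l , r , p , ())
encode-step⁻¹ (b ∷ u) (b ∷ v) (_ ∷ _ ∷ _ ∷ l , r , p , q) = Replace-∷ b (encode-step⁻¹ u v
  ( l , r , ∷-injectiveʳ (∷-injectiveʳ (∷-injectiveʳ p))
  , ∷-injectiveʳ (∷-injectiveʳ (∷-injectiveʳ q))))

encode-length : ∀ w → length (encode w) ≡ 1 + (2 * #a w + 3 * #b w)
encode-length []      = refl
encode-length (a ∷ w) =
  trans (cong (2 +_) (encode-length w)) (lemma (#a w) (#b w))
  where
  lemma : ∀ x y → 2 + (1 + (2 * x + 3 * y)) ≡ 1 + (2 * (1 + x) + 3 * y)
  lemma = solve-∀
encode-length (b ∷ w) =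
  trans (cong (3 +_) (encode-length w)) (lemma (#a w) (#b w))
  where
  lemma : ∀ x y → 3 + (1 + (2 * x + 3 * y)) ≡ 1 + (2 * x + 3 * (1 + y))
  lemma = solve-∀

encode-#1 : ∀ w → #1 (encode w) ≡ #a w + 2 * #b w
encode-#1 []      = refl
encode-#1 (a ∷ w) = cong suc (encode-#1 w)
encode-#1 (b ∷ w) = trans (cong (2 +_) (encode-#1 w)) (lemma (#a w) (#b w))
  where
  lemma : ∀ x y → 2 + (x + 2 * y) ≡ x + 2 * (1 + y)
  lemma = solve-∀

-- The linear system has determinant 1: twice `x + 2 * y` exceeds `2 * x + 3 * y` by exactly `y`.
-- Cancellation of a common summand replaces subtraction.
block-counts-unique : ∀ {x y p q} → 1 + (2 * x + 3 * y) ≡ 1 + (2 * p + 3 * q) →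
                      x + 2 * y ≡ p + 2 * q → x ≡ p × y ≡ q
block-counts-unique {x} {y} {p} {q} e₁ e₂ = x≡p , sym q≡y
  where
  open ≡-Reasoning
  double : ∀ x y → 2 * (x + 2 * y) ≡ y + (2 * x + 3 * y)
  double = solve-∀

  q≡y : q ≡ y
  q≡y = +-cancelʳ-≡ (2 * p + 3 * q) q y (begin
    q + (2 * p + 3 * q)  ≡⟨ double p q ⟨
    2 * (p + 2 * q)      ≡⟨ cong (2 *_) e₂ ⟨
    2 * (x + 2 * y)      ≡⟨ double x y ⟩
    y + (2 * x + 3 * y)  ≡⟨ cong (y +_) (suc-injective e₁) ⟩
    y + (2 * p + 3 * q)  ∎)

  x≡p : x ≡ p
  x≡p = +-cancelʳ-≡ (2 * y) x p (trans e₂ (cong (λ z → p + 2 * z) q≡y))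

-- With the length and the number of ones written in terms of `p` and `q`, no truncated subtraction
-- enters the bijection.
Φ≅A : ∀ p q → Φ (1 + (2 * p + 3 * q)) (p + 2 * q) ≅ A⟨ p , q ⟩
Φ≅A p q = symmetricGraph-≅ (List.≡-dec Fin._≟_) (List.≡-dec _≟ᴸ_) decode encode
  decode-pres
  (λ { {w} (_ , refl , refl) → encode-padovan w , encode-length w , encode-#1 w })
  (λ {w} _ → decode∘encode w)
  (λ (P , _) → encode∘decode P)
  -- Both words are first rewritten as codes of their decodings.
  (λ {u} {v} P P′ s → encode-step⁻¹ (decode u) (decode v)
    (subst₂ (Replace 0F 1F)
      (sym (recompute (List.≡-dec Fin._≟_ _ _) (encode∘decode (proj₁ P))))
      (sym (recompute (List.≡-dec Fin._≟_ _ _) (encode∘decode (proj₁ P′)))) s))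
  (λ _ _ → encode-step)
  (λ {v} → SimpleGraph.~-irr (Φ (1 + (2 * p + 3 * q)) (p + 2 * q)) {v})
  (λ {v} → SimpleGraph.~-irr A⟨ p , q ⟩ {v})
  where
  decode-pres : ∀ {w} →
    Padovan w × length w ≡ 1 + (2 * p + 3 * q) × #1 w ≡ p + 2 * q →
    length (decode w) ≡ p + q × #a (decode w) ≡ p × #b (decode w) ≡ q
  decode-pres {w} (P , len , ones) =
    trans (length≡#a+#b (decode w)) (cong₂ _+_ (proj₁ counts) (proj₂ counts)) , counts
    where
    eq : encode (decode w) ≡ w
    eq = encode∘decode P

    counts : #a (decode w) ≡ p × #b (decode w) ≡ q
    counts = block-counts-unique
      (trans (sym (encode-length (decode w))) (trans (cong length eq) len))
      (trans (sym (encode-#1 (decode w))) (trans (cong #1 eq) ones))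

-- Words in `a` and `b` as partitions.

-- The value is meaningful only when w has exactly q letters b; otherwise the
-- sequence is truncated or padded with zeros.
toPartition : ∀ q → List Letter → Vec ℕ q
toPartition q       []      = Vec.replicate q 0
toPartition q       (a ∷ w) = toPartition q w
toPartition zero    (b ∷ w) = []
toPartition (suc q) (b ∷ w) = #a w ∷ toPartition q w

-- The argument `p` is the number of letters `a` still to be placed; the runs of `a` are the gaps
-- between consecutive parts. The trailing `++ []` gives both clauses the shape of the lemmas on
-- `replicate m a ++ w`.
fromPartition : ∀ {q} → ℕ → Vec ℕ q → List Letter
fromPartition p []      = replicate p a ++ []
fromPartition p (x ∷ μ) = replicate (p ∸ x) a ++ b ∷ fromPartition x μ

Linked-≥-suc : ∀ {p q} {μ : Vec ℕ q} → Linked _≥_ (p ∷ μ) → Linked _≥_ (suc p ∷ μ)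
Linked-≥-suc [-]     = [-]
Linked-≥-suc (h ∷ l) = m≤n⇒m≤1+n h ∷ l

-- A letter `a` raises the bound by one, and a letter `b` makes the current bound the first part.
toPartition-linked : ∀ w → Linked _≥_ (#a w ∷ toPartition (#b w) w)
toPartition-linked []      = [-]
toPartition-linked (a ∷ w) = Linked-≥-suc (toPartition-linked w)
toPartition-linked (b ∷ w) = ≤-refl ∷ toPartition-linked w

toPartition-aᵐ++ : ∀ q m w → toPartition q (replicate m a ++ w) ≡ toPartition q w
toPartition-aᵐ++ q zero    w = refl
toPartition-aᵐ++ q (suc m) w = toPartition-aᵐ++ q m w

#a-aᵐ++ : ∀ m w → #a (replicate m a ++ w) ≡ m + #a w
#a-aᵐ++ zero    w = refl
#a-aᵐ++ (suc m) w = cong suc (#a-aᵐ++ m w)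

#b-aᵐ++ : ∀ m w → #b (replicate m a ++ w) ≡ #b w
#b-aᵐ++ zero    w = refl
#b-aᵐ++ (suc m) w = #b-aᵐ++ m w

aᵐ++a∷ : ∀ m w → replicate m a ++ a ∷ w ≡ a ∷ replicate m a ++ w
aᵐ++a∷ zero    w = refl
aᵐ++a∷ (suc m) w = cong (a ∷_) (aᵐ++a∷ m w)

#a-fromPartition : ∀ {p q} {μ : Vec ℕ q} → Linked _≥_ (p ∷ μ) →
                   #a (fromPartition p μ) ≡ p
#a-fromPartition {p} {μ = []}    [-]     = trans (#a-aᵐ++ p []) (+-identityʳ p)
#a-fromPartition {p} {μ = x ∷ μ} (h ∷ l) = trans (#a-aᵐ++ (p ∸ x) _)
  (trans (cong (p ∸ x +_) (#a-fromPartition l)) (m∸n+n≡m h))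

#b-fromPartition : ∀ {q} p (μ : Vec ℕ q) → #b (fromPartition p μ) ≡ q
#b-fromPartition p []      = #b-aᵐ++ p []
#b-fromPartition p (x ∷ μ) =
  trans (#b-aᵐ++ (p ∸ x) _) (cong suc (#b-fromPartition x μ))

toPartition∘fromPartition : ∀ {p q} {μ : Vec ℕ q} → Linked _≥_ (p ∷ μ) →
                            toPartition q (fromPartition p μ) ≡ μ
toPartition∘fromPartition {p} {μ = []}    [-]     = toPartition-aᵐ++ 0 p []
toPartition∘fromPartition {p} {μ = x ∷ μ} (h ∷ l) = trans (toPartition-aᵐ++ _ (p ∸ x) _)
  (cong₂ _∷_ (#a-fromPartition l) (toPartition∘fromPartition l))

-- The chain gives `x ≤ p`, so the first gap really grows by one.
fromPartition-suc : ∀ {p q} {μ : Vec ℕ q} → Linked _≥_ (p ∷ μ) →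
                    fromPartition (suc p) μ ≡ a ∷ fromPartition p μ
fromPartition-suc [-]             = refl
fromPartition-suc {μ = x ∷ μ} (h ∷ l) =
  cong (λ m → replicate m a ++ b ∷ fromPartition x μ) (+-∸-assoc 1 h)

fromPartition∘toPartition : ∀ w → fromPartition (#a w) (toPartition (#b w) w) ≡ w
fromPartition∘toPartition []      = refl
fromPartition∘toPartition (a ∷ w) =
  trans (fromPartition-suc (toPartition-linked w)) (cong (a ∷_) (fromPartition∘toPartition w))
fromPartition∘toPartition (b ∷ w) rewrite n∸n≡0 (#a w) =
  cong (b ∷_) (fromPartition∘toPartition w)

#a-Replace : ∀ l r → #a (l ++ b ∷ a ∷ r) ≡ #a (l ++ a ∷ b ∷ r)
#a-Replace []      r = refl
#a-Replace (a ∷ l) r = cong suc (#a-Replace l r)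
#a-Replace (b ∷ l) r = #a-Replace l r

-- Only the exchanged `b` gains an `a` to its right. Both sequences are indexed by `#b u` so that
-- they have the same type.
toPartition-step : ∀ {u v} → Replace a b u v →
                   AddOne (toPartition (#b u) u) (toPartition (#b u) v)
toPartition-step ([]    , r , refl , refl) = zero , refl
toPartition-step (a ∷ l , r , refl , refl) = toPartition-step (l , r , refl , refl)
toPartition-step (b ∷ l , r , refl , refl) with toPartition-step (l , r , refl , refl)
... | i , eq = suc i , cong₂ _∷_ (#a-Replace l r) eq

fromPartition-step : ∀ {p q} {μ ν : Vec ℕ q} → Linked _≥_ (p ∷ μ) → Linked _≥_ (p ∷ ν) →
                     AddOne μ ν → Replace a b (fromPartition p μ) (fromPartition p ν)
-- The chain of the enlarged sequence gives `h : x ≤ p`, so the run before this `b` is nonempty; its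
-- last `a` moves past the `b`.
fromPartition-step {suc p} {μ = x ∷ μ} (_ ∷ l) (s≤s h ∷ _) (zero , refl) =
  subst₂ (Replace a b)
    (trans (aᵐ++a∷ (p ∸ x) _)
      (cong (λ m → replicate m a ++ b ∷ fromPartition x μ) (sym (+-∸-assoc 1 h))))
    (cong (λ w → replicate (p ∸ x) a ++ b ∷ w) (sym (fromPartition-suc l)))
    (replicate (p ∸ x) a , fromPartition x μ , refl , refl)
fromPartition-step {p} {μ = x ∷ μ} (_ ∷ l) (_ ∷ l′) (suc i , refl) =
  Replace-++ (replicate (p ∸ x) a)
    (Replace-∷ b (fromPartition-step l l′ (i , refl)))

A≅Π : ∀ p q → A⟨ p , q ⟩ ≅ Π⟨ p , q ⟩
A≅Π p q = symmetricGraph-≅ (List.≡-dec _≟ᴸ_) (Vec.≡-dec _≟_)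
  (toPartition q) (fromPartition p)
  (λ { {w} (_ , refl , refl) → toPartition-linked w })
  (λ {μ} l →
    trans (length≡#a+#b (fromPartition p μ))
      (cong₂ _+_ (#a-fromPartition l) (#b-fromPartition p μ)) ,
    #a-fromPartition l , #b-fromPartition p μ)
  toPartition∘fromPartition
  (λ { {w} (_ , refl , refl) → fromPartition∘toPartition w })
  -- The index `#b u` is transported to `q`.
  (λ {u} {v} P _ s → subst (λ q → AddOne (toPartition q u) (toPartition q v))
    (recompute (#b u ≟ q) (proj₂ (proj₂ P))) (toPartition-step s))
  (λ l l′ → fromPartition-step (recompute (linked? _≥?_ _) l) (recompute (linked? _≥?_ _) l′))
  (λ {v} → SimpleGraph.~-irr A⟨ p , q ⟩ {v})
  (λ {v} → SimpleGraph.~-irr Π⟨ p , q ⟩ {v})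

-- Arithmetic of the parameters.

n/2≤k⇒n≤2k+1 : ∀ {n k} → n / 2 ≤ k → n ≤ 2 * k + 1
n/2≤k⇒n≤2k+1 {n} {k} h = begin
  n                  ≡⟨ m≡m%n+[m/n]*n n 2 ⟩
  -- The remainder modulo 2 is at most 1.
  n % 2 + n / 2 * 2  ≤⟨ +-mono-≤ (≤-pred (m%n<n n 2)) (*-monoˡ-≤ 2 h) ⟩
  1 + k * 2          ≡⟨ lemma k ⟩
  2 * k + 1          ∎
  where
  open ≤-Reasoning
  lemma : ∀ k → 1 + k * 2 ≡ 2 * k + 1
  lemma = solve-∀

k≤[2n-2]/3⇒3k+2≤2n : ∀ {n k} → 1 ≤ n → k ≤ (2 * n ∸ 2) / 3 → 3 * k + 2 ≤ 2 * n
k≤[2n-2]/3⇒3k+2≤2n {n} {k} 1≤n h = begin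
  3 * k + 2                    ≡⟨ cong (_+ 2) (*-comm 3 k) ⟩
  k * 3 + 2                    ≤⟨ +-monoˡ-≤ 2 (*-monoˡ-≤ 3 h) ⟩
  (2 * n ∸ 2) / 3 * 3 + 2      ≤⟨ +-monoˡ-≤ 2 (m/n*n≤m (2 * n ∸ 2) 3) ⟩
  -- Here `1 ≤ n` keeps the subtraction from truncating.
  2 * n ∸ 2 + 2                ≡⟨ m∸n+n≡m (*-monoʳ-≤ 2 1≤n) ⟩
  2 * n                        ∎
  where open ≤-Reasoning

-- The hypotheses are the definitions of `p` and `q` in additive form; in `p + 2 * q` the multiples
-- of `n` cancel.
k≡p+2q : ∀ {n k p q} → p + (3 * k + 2) ≡ 2 * n → q + n ≡ 2 * k + 1 → p + 2 * q ≡ k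
k≡p+2q {n} {k} {p} {q} ep eq = +-cancelʳ-≡ (3 * k + 2) (p + 2 * q) k (begin
  p + 2 * q + (3 * k + 2)    ≡⟨ rearrange p q (3 * k + 2) ⟩
  2 * q + (p + (3 * k + 2))  ≡⟨ cong (2 * q +_) ep ⟩
  2 * q + 2 * n              ≡⟨ *-distribˡ-+ 2 q n ⟨
  2 * (q + n)                ≡⟨ cong (2 *_) eq ⟩
  2 * (2 * k + 1)            ≡⟨ expand k ⟩
  k + (3 * k + 2)            ∎)
  where
  open ≡-Reasoning
  rearrange : ∀ p q m → p + 2 * q + m ≡ 2 * q + (p + m)
  rearrange = solve-∀
  expand : ∀ k → 2 * (2 * k + 1) ≡ k + (3 * k + 2)
  expand = solve-∀

n≡1+2p+3q : ∀ {n k p q} → p + 2 * q ≡ k → q + n ≡ 2 * k + 1 → 1 + (2 * p + 3 * q) ≡ n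
n≡1+2p+3q {n} {k} {p} {q} refl eq =
  +-cancelˡ-≡ q (1 + (2 * p + 3 * q)) n (trans (lemma p q) (sym eq))
  where
  lemma : ∀ p q → q + (1 + (2 * p + 3 * q)) ≡ 2 * (p + 2 * q) + 1
  lemma = solve-∀

theorem2p6 : (n k : ℕ) → 1 ≤ n → n / 2 ≤ k → k ≤ (2 * n ∸ 2) / 3 →
    let p = 2 * n ∸ (3 * k + 2)
        q = (2 * k + 1) ∸ n
    in (Φ n k ≅ A⟨ p , q ⟩) × (A⟨ p , q ⟩ ≅ Π⟨ p , q ⟩) × (Φ n k ≅ Π⟨ p , q ⟩)
theorem2p6 n k 1≤n n/2≤k k≤ = Φ≅A′ , A≅Π p q , ≅-trans Φ≅A′ (A≅Π p q)
  where
  p q : ℕ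
  p = 2 * n ∸ (3 * k + 2)
  q = (2 * k + 1) ∸ n

  q+n≡2k+1 : q + n ≡ 2 * k + 1
  q+n≡2k+1 = m∸n+n≡m (n/2≤k⇒n≤2k+1 {n} n/2≤k)

  p+2q≡k : p + 2 * q ≡ k
  p+2q≡k = k≡p+2q {n} {k} {p} (m∸n+n≡m (k≤[2n-2]/3⇒3k+2≤2n 1≤n k≤)) q+n≡2k+1

  Φ≅A′ : Φ n k ≅ A⟨ p , q ⟩
  Φ≅A′ = subst₂ (λ n k → Φ n k ≅ A⟨ p , q ⟩) (n≡1+2p+3q {p = p} p+2q≡k q+n≡2k+1) p+2q≡k (Φ≅A p q)
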